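{- Let $c_0,c_1,c_2,\ldots$ be an infinite sequence of elements of $Z$ with $c_j\in Z^*$ for all $j\ge 1$. Then the sequence of convergents $\frac{s_n}{t_n}=[c_0;c_1,\dots,c_n]$ converges to an element $\alpha$ of $K$. Moreover, for every $n\ge 0$, $$\left|\alpha-\frac{s_n}{t_n}\right|=\frac{1}{|t_n|\,|t_{n+1}|}.$$
   Context: Let $p$ be a prime and let $K$ be a finite extension of $\mathbb{Q}_p$ of degree $m$, with ramification index $e$ and residue degree $f$ (so $m=ef$). Let $|\cdot|$ be the unique extension to $K$ of the $p$-adic absolute value with $|p|=p^{ -1}$. Let $L\subseteq K$ be the unramified subextension of degree $f$ over $\mathbb{Q}_p$, write $L=\mathbb{Q}_p(\gamma)$ with $\gamma$ a primitive $(p^f-1)$-th root of unity, and fix $\beta\in K$ with $K=L(\beta)$ and $|\beta|=p^{1/e}$. Let $D$ be either $\{0,1,\dots,p-1\}$ or (for $p$ odd) $\{ -\frac{p-1}{2},\dots,\frac{p-1}{2}\}$; the claim is made for each choice. Let $X=\{\sum_{j=0}^{k}a_jp^{ -j} : k\in\mathbb{N}\cup\{0\},\ a_j\in D\}$, $Z=\{\sum_{i=0}^{e-1}\sum_{j=0}^{f-1}b_{i,j}\gamma^j\beta^i : b_{i,j}\in X\}$, and $Z^*=\{c\in Z : |c|>1\}$. Here $[c_0;c_1,\dots,c_n]=c_0+\cfrac{1}{c_1+\cfrac{1}{\ddots+\cfrac{1}{c_n}}}$. The sequences $(s_n)$ and $(t_n)$ are defined by $s_0=c_0$, $t_0=1$,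 $s_1=c_0c_1+1$, $t_1=c_1$, and $s_n=c_ns_{n-1}+s_{n-2}$, $t_n=c_nt_{n-1}+t_{n-2}$ for $n\ge 2$. -}

module Defs where

open import Level using (Level; _⊔_) renaming (suc to lsuc)
open import Algebra.Bundles using (CommutativeRing; Semiring)
open import Algebra.Apartness.Bundles using (HeytingField; HeytingCommutativeRing)
open import Algebra.Morphism.Structures using (module RingMorphisms)
import Algebra.Definitions.RawMonoid as RawMonoidDefs
import Algebra.Definitions.RawSemiring as RawSemiringDefs
open import Data.Fin.Base using (Fin; toℕ)
open import Data.Integer.Base as ℤ using (ℤ; +_)
open import Data.Nat.Base as ℕ using (ℕ; zero; suc; NonZero)
open import Data.Nat.Divisibility using (_∣_; _∤_)
open import Data.Nat.Properties using (m^n≢0)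
open import Data.Product.Base using (Σ; Σ-syntax; ∃; ∃-syntax; _×_; proj₁)
open import Data.Rational.Base as ℚ using (ℚ; _/_; ↥_; ↧ₙ_)
open import Data.Sum.Base using (_⊎_)
open import Function.Bundles using (_⇔_)
open import Relation.Binary.PropositionalEquality.Core using (_≡_)
open import Relation.Nullary.Negation.Core using (¬_)
open import Relation.Unary using (Pred; _∈_)

private variable
  c ℓ₁ ℓ₂ c′ ℓ₁′ ℓ₂′ ℓ : Level

-- A field with a nonarchimedean absolute value, all of whose nonzero values
-- are rational powers of a prime p, as is the case for every finite extension
-- of ℚₚ.  For x # 0# the number  log x#0  is the exponent: |x| = p ^ log x#0.
-- The value |0| = 0 is implicit: equality on ℚₚ is undecidable, so |x| is not
-- given by a total function to ℚ ∪ {-∞}.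
record ValuedField c ℓ₁ ℓ₂ : Set (lsuc (c ⊔ ℓ₁ ⊔ ℓ₂)) where
  field
    heytingField : HeytingField c ℓ₁ ℓ₂

  open HeytingField heytingField public

  field
    log      : ∀ {x} → x # 0# → ℚ
    log-cong : ∀ {x y} → x ≈ y → (x#0 : x # 0#) (y#0 : y # 0#) → log x#0 ≡ log y#0
    log-*    : ∀ {x y} (x#0 : x # 0#) (y#0 : y # 0#) (xy#0 : x * y # 0#) →
               log xy#0 ≡ log x#0 ℚ.+ log y#0
    -- |x + y| ≤ max (|x|, |y|)
    log-+    : ∀ {x y} (x+y#0 : x + y # 0#) →
               (Σ[ x#0 ∈ x # 0# ] log x+y#0 ℚ.≤ log x#0) ⊎
               (Σ[ y#0 ∈ y # 0# ] log x+y#0 ℚ.≤ log y#0)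

  commutativeRing : CommutativeRing c ℓ₁
  commutativeRing = HeytingCommutativeRing.commutativeRing heytingCommutativeRing

  open CommutativeRing commutativeRing public using (rawRing; semiring)
  open RawSemiringDefs (Semiring.rawSemiring semiring) public using (_^_; sum) renaming (_×_ to _·_)

  -- #⇒invertible x#0 provides an inverse of x - 0#.
  infix 9 _⁻¹
  _⁻¹ : ∀ {x} → x # 0# → Carrier
  x#0 ⁻¹ = proj₁ (#⇒invertible x#0)

  infixl 7 _÷_
  _÷_ : ∀ (x : Carrier) {y} → y # 0# → Carrier
  x ÷ y#0 = x * y#0 ⁻¹

  infix 4 ∣_∣≡p^_ ∣_∣≤p^_ ∣_∣<p^_ ∣_∣>1

  ∣_∣≡p^_ : Carrier → ℚ → Set ℓ₂
  ∣ x ∣≡p^ q = Σ[ x#0 ∈ x # 0# ] log x#0 ≡ q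

  ∣_∣≤p^_ : Carrier → ℚ → Set ℓ₂
  ∣ x ∣≤p^ q = ∀ (x#0 : x # 0#) → log x#0 ℚ.≤ q

  ∣_∣<p^_ : Carrier → ℚ → Set ℓ₂
  ∣ x ∣<p^ q = ∀ (x#0 : x # 0#) → log x#0 ℚ.< q

  ∣_∣>1 : Carrier → Set ℓ₂
  ∣ x ∣>1 = Σ[ x#0 ∈ x # 0# ] ℚ.0ℚ ℚ.< log x#0

  -- As ε > 0, the numbers p^-N suffice.
  infix 4 ∣_∣≤p^-_
  ∣_∣≤p^-_ : Carrier → ℕ → Set ℓ₂
  ∣ x ∣≤p^- N = ∣ x ∣≤p^ (ℚ.- (+ N / 1))

  IsCauchy : (ℕ → Carrier) → Set ℓ₂
  IsCauchy x = ∀ N → ∃[ M ] ∀ i j → M ℕ.≤ i → M ℕ.≤ j → ∣ x i - x j ∣≤p^- N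

  infix 4 _⟶_
  _⟶_ : (ℕ → Carrier) → Carrier → Set ℓ₂
  x ⟶ α = ∀ N → ∃[ M ] ∀ i → M ℕ.≤ i → ∣ x i - α ∣≤p^- N

  IsComplete : Set (c ⊔ ℓ₂)
  IsComplete = ∀ x → IsCauchy x → ∃[ α ] x ⟶ α

  -- S(a), the smallest subfield containing S and a.
  data Adjoin (S : Pred Carrier ℓ) (a : Carrier) : Carrier → Set (c ⊔ ℓ₁ ⊔ ℓ₂ ⊔ ℓ) where
    base : ∀ {x} → x ∈ S → Adjoin S a x
    gen  : Adjoin S a a
    0#∈  : Adjoin S a 0#
    1#∈  : Adjoin S a 1#
    add  : ∀ {x y} → Adjoin S a x → Adjoin S a y → Adjoin S a (x + y)
    neg  : ∀ {x} → Adjoin S a x → Adjoin S a (- x)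
    mul  : ∀ {x y} → Adjoin S a x → Adjoin S a y → Adjoin S a (x * y)
    inv  : ∀ {x} (x#0 : x # 0#) → Adjoin S a x → Adjoin S a (x#0 ⁻¹)
    resp : ∀ {x y} → x ≈ y → Adjoin S a x → Adjoin S a y

  IsPrimitiveRoot : ℕ → Carrier → Set ℓ₁
  IsPrimitiveRoot n γ = γ ^ n ≈ 1# × (∀ k → 0 ℕ.< k → k ℕ.< n → ¬ (γ ^ k ≈ 1#))

  -- For a finite extension of ℚₚ inside the field, with underlying set S:
  -- its value group |S^×| is p^((1/e)ℤ).
  HasRamificationIndex : Pred Carrier ℓ → (e : ℕ) .{{_ : NonZero e}} → Set (c ⊔ ℓ₂ ⊔ ℓ)
  HasRamificationIndex S e =
    (∀ {x} → x ∈ S → (x#0 : x # 0#) → ∃[ k ] log x#0 ≡ k / e) ×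
    (∀ (k : ℤ) → ∃[ x ] x ∈ S × ∣ x ∣≡p^ (k / e))

  -- 𝒪/𝔪 has an 𝔽ₚ-basis of f elements, where 𝒪 = {|x| ≤ 1}, 𝔪 = {|x| < 1};
  -- Fin p serves as a set of representatives of 𝔽ₚ.
  HasResidueDegree : (p f : ℕ) → Set (c ⊔ ℓ₂)
  HasResidueDegree p f = Σ[ u ∈ (Fin f → Carrier) ]
    (∀ i → ∣ u i ∣≤p^ ℚ.0ℚ) ×
    (∀ x → ∣ x ∣≤p^ ℚ.0ℚ → ∃[ a ] ∣ x - combination u a ∣<p^ ℚ.0ℚ) ×
    (∀ a b → ∣ combination u a - combination u b ∣<p^ ℚ.0ℚ → ∀ i → a i ≡ b i)
    where
    combination : (Fin f → Carrier) → (Fin f → Fin p) → Carrier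
    combination u a = sum λ i → toℕ (a i) · u i

  -- The continued fraction [ a 0 ; a 1 , … , a n ] is defined and equal to x.
  ContinuedFraction : (ℕ → Carrier) → ℕ → Carrier → Set (c ⊔ ℓ₁ ⊔ ℓ₂)
  ContinuedFraction a zero    x = Level.Lift (c ⊔ ℓ₂) (x ≈ a 0)
  ContinuedFraction a (suc n) x =
    ∃[ y ] ContinuedFraction (λ j → a (suc j)) n y ×
    (Σ[ y#0 ∈ y # 0# ] x ≈ a 0 + y#0 ⁻¹)

  numerator : (ℕ → Carrier) → ℕ → Carrier
  numerator a 0             = a 0
  numerator a 1             = a 0 * a 1 + 1#
  numerator a (suc (suc n)) = a (suc (suc n)) * numerator a (suc n) + numerator a n

  denominator : (ℕ → Carrier) → ℕ → Carrier
  denominator a 0             = 1#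
  denominator a 1             = a 1
  denominator a (suc (suc n)) = a (suc (suc n)) * denominator a (suc n) + denominator a n

-- p ^ i exactly divides n.
ExactPower : (p i n : ℕ) → Set
ExactPower p i n = p ℕ.^ i ∣ n × p ℕ.^ suc i ∤ n

-- F is the field ℚₚ, that is, the completion of ℚ for the p-adic absolute
-- value; this determines F up to a unique isometric isomorphism.
record IsPadicNumbers (p : ℕ) (F : ValuedField c ℓ₁ ℓ₂) : Set (c ⊔ ℓ₁ ⊔ ℓ₂) where
  open ValuedField F
  open RingMorphisms ℚ.+-*-rawRing rawRing using (IsRingHomomorphism)

  field
    fromℚ              : ℚ → Carrier
    isRingHomomorphism : IsRingHomomorphism fromℚ
    isometric          : ∀ q {i j} → ExactPower p i ℤ.∣ ↥ q ∣ → ExactPower p j (↧ₙ q) →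
                         ∣ fromℚ q ∣≡p^ ((+ j ℤ.- + i) / 1)
    dense              : ∀ x N → ∃[ q ] ∣ x - fromℚ q ∣≤p^- N
    complete           : IsComplete

-- A field extension K of F whose absolute value extends that of F.
record Extension (F : ValuedField c ℓ₁ ℓ₂) (K : ValuedField c′ ℓ₁′ ℓ₂′) :
                 Set (c ⊔ ℓ₁ ⊔ ℓ₂ ⊔ c′ ⊔ ℓ₁′ ⊔ ℓ₂′) where
  private
    module F = ValuedField F
    module K = ValuedField K
  open RingMorphisms F.rawRing K.rawRing using (IsRingHomomorphism)

  field
    embed              : F.Carrier → K.Carrier
    isRingHomomorphism : IsRingHomomorphism embed
    isometric          : ∀ x q → (F.∣ x ∣≡p^ q) ⇔ (K.∣ embed x ∣≡p^ q)

  Base : Pred K.Carrier (c ⊔ ℓ₁′)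
  Base x = ∃[ a ] x K.≈ embed a

  -- The F-subspace S of K has a basis of n elements.
  HasDegree : Pred K.Carrier ℓ → ℕ → Set (c ⊔ ℓ₁ ⊔ c′ ⊔ ℓ₁′ ⊔ ℓ)
  HasDegree S n = Σ[ v ∈ (Fin n → K.Carrier) ]
    (∀ i → v i ∈ S) ×
    (∀ x → x ∈ S → ∃[ a ] x K.≈ combination v a) ×
    (∀ a → combination v a K.≈ K.0# → ∀ i → a i F.≈ F.0#)
    where
    combination : (Fin n → K.Carrier) → (Fin n → F.Carrier) → K.Carrier
    combination v a = K.sum λ i → embed (a i) K.* v i

data DigitSet (p : ℕ) : Set where
  standard : DigitSet p
  balanced : 2 ∤ p → DigitSet p

Digit : ∀ {p} → DigitSet p → Pred ℤ _
Digit {p} standard     a = ∃[ d ] d ℕ.< p × a ≡ + d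
Digit {p} (balanced _) a = ℤ.∣ a ∣ ℕ.≤ (p ℕ.∸ 1) ℕ./ 2

X : ∀ {p} .{{_ : NonZero p}} → DigitSet p → Pred ℚ _
X {p} D q = ∃[ k ] Σ[ a ∈ (Fin (suc k) → ℤ) ]
  (∀ j → a j ∈ Digit D) ×
  q ≡ RawMonoidDefs.sum ℚ.+-0-rawMonoid λ j → _/_ (a j) (p ℕ.^ toℕ j) {{m^n≢0 p (toℕ j)}}

module _ {p} .{{_ : NonZero p}} {Qp : ValuedField c ℓ₁ ℓ₂} (isQp : IsPadicNumbers p Qp)
         {K : ValuedField c′ ℓ₁′ ℓ₂′} (E : Extension Qp K) where
  open ValuedField K
  open IsPadicNumbers isQp using (fromℚ)
  open Extension E using (embed)

  Z : (e f : ℕ) (γ β : Carrier) → DigitSet p → Pred Carrier ℓ₁′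
  Z e f γ β D x = Σ[ b ∈ (Fin e → Fin f → ℚ) ]
    (∀ i j → b i j ∈ X D) ×
    x ≈ (sum λ i → sum λ j → embed (fromℚ (b i j)) * γ ^ toℕ j * β ^ toℕ i)

  Z* : (e f : ℕ) (γ β : Carrier) → DigitSet p → Pred Carrier (ℓ₁′ ⊔ ℓ₂′)
  Z* e f γ β D x = x ∈ Z e f γ β D × ∣ x ∣>1

-- As |c_n| > 1, the ultrametric inequality gives |t_{n+1}| = |c_{n+1}| |t_n|, and
-- s_{n+1} t_n - s_n t_{n+1} = ±1, so consecutive convergents differ by exactly
-- 1 / (|t_n| |t_{n+1}|).  These values decrease strictly, hence any later
-- convergent, and therefore the limit, has that same distance from the n-th one.
-- The value group (1/e)ℤ forces |t_n| ≥ p ^ (n / e), so the convergents are Cauchy.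
--
-- Completeness of K does not go through the equivalence of norms, which would
-- need a constructive lower bound for norms on a finite-dimensional space.
-- Instead, the residue degree and the ramification index yield finitely many w_i
-- whose ℕ-combinations approximate every integer of K modulo p.  Iterating, a
-- limit is found in the form x₀ + Σ q_i w_i with coefficients q_i ∈ ℚₚ given by
-- their p-adic digits.
module Submission where

open import Defs
open import Algebra.Apartness.Bundles using (HeytingField)
import Algebra.Apartness.Properties.HeytingCommutativeRing as HeytingProperties
open import Algebra.Bundles using (CommutativeRing; Monoid; RawRing)
open import Algebra.Morphism.Structures using (module RingMorphisms)
import Algebra.Properties.CommutativeSemigroup as CommutativeSemigroupProperties
import Algebra.Properties.Monoid.Sum as MonoidSum
import Algebra.Properties.Ring as RingProperties
import Algebra.Properties.Semiring.Mult as Mult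
import Algebra.Properties.Semiring.Sum as SemiringSum
import Algebra.Solver.Ring as Solver
open import Algebra.Solver.Ring.AlmostCommutativeRing
  using (fromCommutativeRing; _-Raw-AlmostCommutative⟶_; Induced-equivalence)
open import Data.Empty using (⊥-elim)
open import Data.Fin.Base using (Fin; zero; suc; toℕ; splitAt)
open import Data.Integer.Base as ℤ using (ℤ; +_; -[1+_])
import Data.Integer.Properties as ℤ
open import Data.Maybe.Base using (just; nothing)
open import Data.Nat.Base as ℕ using (ℕ; zero; suc; _∸_; NonZero) renaming (_^_ to _^ℕ_)
open import Data.Nat.Coprimality using (1-coprimeTo) renaming (sym to coprime-sym)
open import Data.Nat.Divisibility using (∣⇒≤; ∣1⇒≡1; ∣-reflexive; ∣-refl)
open import Data.Nat.Primality using (Prime; prime⇒nonTrivial)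
import Data.Nat.Properties as ℕ
open import Data.Product.Base using (Σ-syntax; ∃-syntax; _×_; _,_; proj₁; proj₂)
open import Data.Rational.Base as ℚ using (ℚ; _/_; 0ℚ; mkℚ; toℚᵘ) renaming (_+_ to _+ℚ_; -_ to -ℚ_)
import Data.Rational.Properties as ℚ
open import Data.Rational.Unnormalised.Base as ℚᵘ using (mkℚᵘ)
import Data.Rational.Unnormalised.Properties as ℚᵘ
open import Data.Sum.Base using (inj₁; inj₂)
open import Data.Vec.Functional using (_++_)
open import Function.Base using (_∘_)
open import Function.Bundles using (Equivalence)
open import Level using (Level; 0ℓ; lift)
open import Relation.Binary.Definitions using (WeaklyDecidable; tri<; tri≈; tri>)
open import Relation.Binary.PropositionalEquality as ≡ using (_≡_)
import Relation.Binary.Reasoning.Setoid as SetoidReasoning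
open import Relation.Nullary.Decidable using (yes; no)
open import Relation.Unary using (U; _∈_)

-- Ring solver with integer coefficients

-- The pair (a , b) stands for the integer a - b; unlike ℤ this makes the
-- homomorphism into the ring definable without case distinctions.
differences : RawRing 0ℓ 0ℓ
differences = record
  { Carrier = ℕ × ℕ
  ; _≈_     = _≡_
  ; _+_     = λ (a , b) (c , d) → a ℕ.+ c , b ℕ.+ d
  ; _*_     = λ (a , b) (c , d) → a ℕ.* c ℕ.+ b ℕ.* d , a ℕ.* d ℕ.+ b ℕ.* c
  ; -_      = λ (a , b) → b , a
  ; 0#      = 0 , 0
  ; 1#      = 1 , 0
  }

module RingSolver {c ℓ} (R : CommutativeRing c ℓ) where
  open CommutativeRing R
  open RingProperties ring
  open CommutativeSemigroupProperties +-commutativeSemigroup using (interchange)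
  open Mult semiring using (×-homo-+; ×1-homo-*; ×-homo-1) renaming (_×_ to _·_)
  open SetoidReasoning setoid

  private
    ⟦_⟧ : ℕ × ℕ → Carrier
    ⟦ a , b ⟧ = a · 1# - b · 1#

    +-minus-+ : ∀ w x y z → (w + x) - (y + z) ≈ (w - y) + (x - z)
    +-minus-+ w x y z = begin
      (w + x) - (y + z)       ≈⟨ +-congˡ (-‿+-comm y z) ⟨
      (w + x) + (- y + - z)   ≈⟨ interchange w x (- y) (- z) ⟩
      (w - y) + (x - z)       ∎

    minus-minus-minus : ∀ w x y z → (w - x) - (y - z) ≈ (w + z) - (x + y)
    minus-minus-minus w x y z = begin
      (w - x) - (y - z)     ≈⟨ +-congˡ (⁻¹-anti-homo‿- y z) ⟩
      (w - x) + (z - y)     ≈⟨ +-minus-+ w z x y ⟨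
      (w + z) - (x + y)     ∎

    ⟦⟧-homo-* : ∀ a b c d →
      ⟦ a ℕ.* c ℕ.+ b ℕ.* d , a ℕ.* d ℕ.+ b ℕ.* c ⟧ ≈ ⟦ a , b ⟧ * ⟦ c , d ⟧
    ⟦⟧-homo-* a b c d = begin
      (a ℕ.* c ℕ.+ b ℕ.* d) · 1# - (a ℕ.* d ℕ.+ b ℕ.* c) · 1#
        ≈⟨ +-cong (products a c b d) (-‿cong (products a d b c)) ⟩
      (A * C + B * D) - (A * D + B * C)
        ≈⟨ minus-minus-minus (A * C) (A * D) (B * C) (B * D) ⟨
      (A * C - A * D) - (B * C - B * D)
        ≈⟨ +-cong (x[y-z]≈xy-xz A C D) (-‿cong (x[y-z]≈xy-xz B C D)) ⟨
      A * (C - D) - B * (C - D)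
        ≈⟨ [y-z]x≈yx-zx (C - D) A B ⟨
      (A - B) * (C - D) ∎
      where
      A = a · 1#
      B = b · 1#
      C = c · 1#
      D = d · 1#
      products : ∀ i j k l → (i ℕ.* j ℕ.+ k ℕ.* l) · 1# ≈ i · 1# * (j · 1#) + k · 1# * (l · 1#)
      products i j k l = trans (×-homo-+ 1# (i ℕ.* j) (k ℕ.* l))
                               (+-cong (×1-homo-* i j) (×1-homo-* k l))

    morphism : differences -Raw-AlmostCommutative⟶ fromCommutativeRing R
    morphism = record
      { ⟦_⟧    = ⟦_⟧
      ; +-homo = λ (a , b) (c , d) → trans
          (+-cong (×-homo-+ 1# a c) (-‿cong (×-homo-+ 1# b d))) (+-minus-+ _ _ _ _)
      ; *-homo = λ (a , b) (c , d) → ⟦⟧-homo-* a b c d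
      ; -‿homo = λ (a , b) → sym (⁻¹-anti-homo‿- (a · 1#) (b · 1#))
      ; 0-homo = -‿inverseʳ 0#
      ; 1-homo = trans (+-cong (×-homo-1 1#) -0#≈0#) (+-identityʳ 1#)
      }

    -- Cross sums compare the integers a - b and c - d. A failed comparison gives `nothing`, as
    -- different integers may still agree in a ring of positive characteristic.
    _≟_ : WeaklyDecidable (Induced-equivalence morphism)
    (a , b) ≟ (c , d) with a ℕ.+ d ℕ.≟ c ℕ.+ b
    ... | no _      = nothing
    ... | yes a+d≡c+b = just (x∙y⁻¹≈ε⇒x≈y _ _ (begin
      (a · 1# - b · 1#) - (c · 1# - d · 1#)  ≈⟨ minus-minus-minus _ _ _ _ ⟩
      (a · 1# + d · 1#) - (b · 1# + c · 1#)  ≈⟨ +-congˡ (-‿cong (+-comm _ _)) ⟩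
      (a · 1# + d · 1#) - (c · 1# + b · 1#)  ≈⟨ x≈y⇒x∙y⁻¹≈ε (begin
        a · 1# + d · 1#    ≈⟨ ×-homo-+ 1# a d ⟨
        (a ℕ.+ d) · 1#     ≡⟨ ≡.cong (_· 1#) a+d≡c+b ⟩
        (c ℕ.+ b) · 1#     ≈⟨ ×-homo-+ 1# c b ⟩
        c · 1# + b · 1#    ∎) ⟩
      0# ∎))

  open Solver differences (fromCommutativeRing R) morphism _≟_ public
    using (solve; _:+_; _:*_; :-_; _:-_; _:=_)

-- Rationals with a fixed denominator

/ᵘ : ∀ i d → toℚᵘ (i / suc d) ℚᵘ.≃ mkℚᵘ i d
/ᵘ i d = ℚ.toℚᵘ-fromℚᵘ (mkℚᵘ i d)

/-homo-+ : ∀ i j n .{{_ : NonZero n}} → i / n ℚ.+ j / n ≡ (i ℤ.+ j) / n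
/-homo-+ i j n@(suc d) = ℚ.toℚᵘ-injective (begin
  toℚᵘ (i / n ℚ.+ j / n)            ≈⟨ ℚ.toℚᵘ-homo-+ (i / n) (j / n) ⟩
  toℚᵘ (i / n) ℚᵘ.+ toℚᵘ (j / n)    ≈⟨ ℚᵘ.+-cong (/ᵘ i d) (/ᵘ j d) ⟩
  mkℚᵘ i d ℚᵘ.+ mkℚᵘ j d            ≈⟨ ℚᵘ.*≡* numerators ⟩
  mkℚᵘ (i ℤ.+ j) d                  ≈⟨ /ᵘ (i ℤ.+ j) d ⟨
  toℚᵘ ((i ℤ.+ j) / n)              ∎)
  where
  open ℚᵘ.≃-Reasoning
  numerators : (i ℤ.* + n ℤ.+ j ℤ.* + n) ℤ.* + n ≡ (i ℤ.+ j) ℤ.* (+ n ℤ.* + n)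
  numerators = ≡.trans (≡.cong (ℤ._* + n) (≡.sym (ℤ.*-distribʳ-+ (+ n) i j)))
                       (ℤ.*-assoc (i ℤ.+ j) (+ n) (+ n))

neg-/ : ∀ i n .{{_ : NonZero n}} → ℚ.- (i / n) ≡ (ℤ.- i) / n
neg-/ i n@(suc d) = ℚ.toℚᵘ-injective (begin
  toℚᵘ (ℚ.- (i / n))     ≈⟨ ℚ.toℚᵘ-homo‿- (i / n) ⟩
  ℚᵘ.- toℚᵘ (i / n)      ≈⟨ ℚᵘ.-‿cong (/ᵘ i d) ⟩
  mkℚᵘ (ℤ.- i) d         ≈⟨ /ᵘ (ℤ.- i) d ⟨
  toℚᵘ ((ℤ.- i) / n)     ∎)
  where open ℚᵘ.≃-Reasoning

*-cancel-/ : ∀ i n .{{_ : NonZero n}} → (i ℤ.* + n) / n ≡ i / 1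
*-cancel-/ i n@(suc d) = ℚ.fromℚᵘ-cong {mkℚᵘ (i ℤ.* + n) d} {mkℚᵘ i 0} (ℚᵘ.*≡* (ℤ.*-identityʳ _))

/-mono-≤ : ∀ n .{{_ : NonZero n}} {i j} → i ℤ.≤ j → i / n ℚ.≤ j / n
/-mono-≤ n@(suc d) {i} {j} i≤j = ℚ.toℚᵘ-cancel-≤ (begin
  toℚᵘ (i / n)   ≃⟨ /ᵘ i d ⟩
  mkℚᵘ i d       ≤⟨ ℚᵘ.*≤* (ℤ.*-monoʳ-≤-nonNeg (+ n) i≤j) ⟩
  mkℚᵘ j d       ≃⟨ /ᵘ j d ⟨
  toℚᵘ (j / n)   ∎)
  where open ℚᵘ.≤-Reasoning

/-cancel-< : ∀ n .{{_ : NonZero n}} {i j} → i / n ℚ.< j / n → i ℤ.< j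
/-cancel-< n {i} {j} i/n<j/n =
  ℤ.≰⇒> λ j≤i → ℚ.<-irrefl ≡.refl (ℚ.<-≤-trans i/n<j/n (/-mono-≤ n j≤i))

archimedean : ∀ q → ∃[ N ] ℚ.- (+ N / 1) ℚ.< q
archimedean q@(mkℚ i d _) = N , ℚ.toℚᵘ-cancel-< (begin-strict
  toℚᵘ (ℚ.- (+ N / 1))       ≡⟨ ≡.cong toℚᵘ (neg-/ (+ N) 1) ⟩
  toℚᵘ (-[1+ ℤ.∣ i ∣ ] / 1)  ≃⟨ /ᵘ (-[1+ ℤ.∣ i ∣ ]) 0 ⟩
  mkℚᵘ -[1+ ℤ.∣ i ∣ ] 0      <⟨ ℚᵘ.*<* (below i) ⟩
  mkℚᵘ i d                   ∎)
  where
  open ℚᵘ.≤-Reasoning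
  -- The denominator is at least 1, so |q| ≤ |i|.
  N = suc ℤ.∣ i ∣
  below : ∀ i → -[1+ ℤ.∣ i ∣ ] ℤ.* + suc d ℤ.< i ℤ.* + 1
  below (+ n)    = ℤ.<-≤-trans ℤ.-<+ (ℤ.≤-reflexive (≡.sym (ℤ.*-identityʳ (+ n))))
  below -[1+ j ] = ℤ.<-≤-trans (ℤ.-<- (ℕ.s≤s⁻¹ (ℕ.m≤m*n (suc (suc j)) (suc d))))
    (ℤ.≤-reflexive (≡.sym (ℤ.*-identityʳ -[1+ j ])))

-- Discreteness of (1/n)ℤ: it turns the strict inequality defining the maximal ideal into a definite
-- gain of 1/n.
/-negative⇒≤-1/ : ∀ n .{{_ : NonZero n}} k → k / n ℚ.< 0ℚ → k / n ℚ.≤ ℤ.- (+ 1) / n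
/-negative⇒≤-1/ n k k/n<0 = /-mono-≤ n {k} (ℤ.i<j⇒i≤pred[j]
  (/-cancel-< n {k} {+ 0} (≡.subst (k / n ℚ.<_) (≡.sym (ℚ.0/n≡0 n)) k/n<0)))

/-positive⇒1/≤ : ∀ n .{{_ : NonZero n}} k → 0ℚ ℚ.< k / n → + 1 / n ℚ.≤ k / n
/-positive⇒1/≤ n k 0<k/n = /-mono-≤ n {+ 1} {k} (ℤ.i<j⇒suc[i]≤j
  (/-cancel-< n {+ 0} {k} (≡.subst (ℚ._< k / n) (≡.sym (ℚ.0/n≡0 n)) 0<k/n)))

-- Calculus of the absolute value

module ValuedFieldProperties {c ℓ₁ ℓ₂} (V : ValuedField c ℓ₁ ℓ₂) where
  open ValuedField V hiding (zero)
  open CommutativeRing commutativeRing using (ring)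
  open HeytingProperties (HeytingField.heytingCommutativeRing heytingField) public
    using (1#0; x#0y#0→xy#0; #-congʳ; x-0≈x; invertibleʳ⇒#)
  open RingProperties ring using (//-rightDividesʳ)
  open RingProperties ring public using (xyx⁻¹≈y)
  open RingSolver commutativeRing

  log-irrelevant : ∀ {x} (x#0 x#0′ : x # 0#) → log x#0 ≡ log x#0′
  log-irrelevant = log-cong refl

  ⁻¹-inverseʳ : ∀ {x} (x#0 : x # 0#) → x * x#0 ⁻¹ ≈ 1#
  ⁻¹-inverseʳ {x} x#0 = trans (*-congʳ (sym (x-0≈x x))) (proj₂ (proj₂ (#⇒invertible x#0)))

  *≈1⇒#0 : ∀ {x y} → x * y ≈ 1# → x # 0#
  *≈1⇒#0 {x} {y} xy≈1 = invertibleʳ⇒# (y , trans (*-congʳ (x-0≈x x)) xy≈1)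

  ⁻¹-unique : ∀ {x y} (x#0 : x # 0#) → x * y ≈ 1# → x#0 ⁻¹ ≈ y
  ⁻¹-unique {x} {y} x#0 xy≈1 = begin
    x#0 ⁻¹              ≈⟨ *-identityʳ _ ⟨
    x#0 ⁻¹ * 1#         ≈⟨ *-congˡ xy≈1 ⟨
    x#0 ⁻¹ * (x * y)    ≈⟨ solve 3 (λ x y z → z :* (x :* y) := (x :* z) :* y) refl x y (x#0 ⁻¹) ⟩
    x * x#0 ⁻¹ * y      ≈⟨ *-congʳ (⁻¹-inverseʳ x#0) ⟩
    1# * y              ≈⟨ *-identityˡ y ⟩
    y                   ∎
    where open SetoidReasoning setoid

  -- An inverse of x is y (xy)⁻¹. This makes the two bounds in `≤p^-*` applicable, since each
  -- requires its factor to be apart from zero.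
  xy#0⇒x#0 : ∀ {x y} → x * y # 0# → x # 0#
  xy#0⇒x#0 xy#0 = *≈1⇒#0 (trans (sym (*-assoc _ _ _)) (⁻¹-inverseʳ xy#0))

  ≡p^-cong : ∀ {x y q} → x ≈ y → ∣ x ∣≡p^ q → ∣ y ∣≡p^ q
  ≡p^-cong x≈y (x#0 , log≡q) =
    let y#0 = #-congʳ x≈y x#0 in y#0 , ≡.trans (log-cong (sym x≈y) y#0 x#0) log≡q

  ≡p^-* : ∀ {x y q r} → ∣ x ∣≡p^ q → ∣ y ∣≡p^ r → ∣ x * y ∣≡p^ (q ℚ.+ r)
  ≡p^-* (x#0 , log-x) (y#0 , log-y) =
    let xy#0 = x#0y#0→xy#0 x#0 y#0 in
    xy#0 , ≡.trans (log-* x#0 y#0 xy#0) (≡.cong₂ ℚ._+_ log-x log-y)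

  -- From 1 · 1 = 1, the exponent l satisfies l + l = l.
  ∣1∣ : ∣ 1# ∣≡p^ 0ℚ
  ∣1∣ = 1#0 , double≡self⇒0 (≡.trans
    (≡.sym (log-* 1#0 1#0 1*1#0)) (log-cong (*-identityˡ 1#) 1*1#0 1#0))
    where
    1*1#0 = x#0y#0→xy#0 1#0 1#0
    double≡self⇒0 : ∀ {q} → q ℚ.+ q ≡ q → q ≡ 0ℚ
    double≡self⇒0 {q} = RingProperties.x+x≈x⇒x≈0 (CommutativeRing.ring ℚ.+-*-commutativeRing) q

  ≡p^-⁻¹ : ∀ {x q} (x#0 : x # 0#) → ∣ x ∣≡p^ q → ∣ x#0 ⁻¹ ∣≡p^ (ℚ.- q)
  ≡p^-⁻¹ {x} {q} x#0 ∣x∣ = x⁻¹#0 ,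
    RingProperties.+-inverseʳ-unique (CommutativeRing.ring ℚ.+-*-commutativeRing) q (log x⁻¹#0)
      (≡.trans (≡.sym (proj₂ ∣1∣′)) (≡.trans (log-irrelevant _ _) (proj₂ ∣1∣)))
    where
    x⁻¹#0 = *≈1⇒#0 (trans (*-comm _ _) (⁻¹-inverseʳ x#0))
    ∣1∣′ = ≡p^-cong (⁻¹-inverseʳ x#0) (≡p^-* ∣x∣ (x⁻¹#0 , ≡.refl))

  neg#0 : ∀ {x} → x # 0# → - x # 0#
  neg#0 {x} x#0 = *≈1⇒#0 (trans
    (solve 2 (λ x y → :- x :* :- y := x :* y) refl x (x#0 ⁻¹)) (⁻¹-inverseʳ x#0))

  ≤p^-cong : ∀ {x y q} → x ≈ y → ∣ x ∣≤p^ q → ∣ y ∣≤p^ q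
  ≤p^-cong x≈y ∣x∣≤ y#0 =
    let x#0 = #-congʳ (sym x≈y) y#0 in
    ℚ.≤-trans (ℚ.≤-reflexive (log-cong (sym x≈y) y#0 x#0)) (∣x∣≤ x#0)

  ≡p^-respʳ : ∀ {x q r} → q ≡ r → ∣ x ∣≡p^ q → ∣ x ∣≡p^ r
  ≡p^-respʳ ≡.refl ∣x∣ = ∣x∣

  ≤p^-respʳ : ∀ {x q r} → q ≡ r → ∣ x ∣≤p^ q → ∣ x ∣≤p^ r
  ≤p^-respʳ ≡.refl ∣x∣≤ = ∣x∣≤

  ≤p^-weaken : ∀ {x q r} → q ℚ.≤ r → ∣ x ∣≤p^ q → ∣ x ∣≤p^ r
  ≤p^-weaken q≤r ∣x∣≤q x#0 = ℚ.≤-trans (∣x∣≤q x#0) q≤r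

  ≡p^⇒≤p^ : ∀ {x q} → ∣ x ∣≡p^ q → ∣ x ∣≤p^ q
  ≡p^⇒≤p^ (x#0 , log≡q) x#0′ = ℚ.≤-reflexive (≡.trans (log-irrelevant x#0′ x#0) log≡q)

  ∣0∣≤p^ : ∀ {x q} → x ≈ 0# → ∣ x ∣≤p^ q
  ∣0∣≤p^ x≈0 x#0 = ⊥-elim (#-irrefl x≈0 x#0)

  ≤p^-+ : ∀ {x y q} → ∣ x ∣≤p^ q → ∣ y ∣≤p^ q → ∣ x + y ∣≤p^ q
  ≤p^-+ ∣x∣≤ ∣y∣≤ x+y#0 with log-+ x+y#0
  ... | inj₁ (x#0 , ≤log-x) = ℚ.≤-trans ≤log-x (∣x∣≤ x#0)
  ... | inj₂ (y#0 , ≤log-y) = ℚ.≤-trans ≤log-y (∣y∣≤ y#0)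

  ≤p^-* : ∀ {x y q r} → ∣ x ∣≤p^ q → ∣ y ∣≤p^ r → ∣ x * y ∣≤p^ (q ℚ.+ r)
  ≤p^-* ∣x∣≤ ∣y∣≤ xy#0 =
    let x#0 = xy#0⇒x#0 xy#0
        y#0 = xy#0⇒x#0 (#-congʳ (*-comm _ _) xy#0) in
    ℚ.≤-trans (ℚ.≤-reflexive (log-* x#0 y#0 xy#0)) (ℚ.+-mono-≤ (∣x∣≤ x#0) (∣y∣≤ y#0))

  -- From (-1)(-1) = 1, the exponent l satisfies l + l = 0, which excludes both 0 < l and l < 0.
  ∣-1∣ : ∣ - 1# ∣≡p^ 0ℚ
  ∣-1∣ = -1#0 , ℚ.≤-antisym (ℚ.≮⇒≥ λ 0<l → ℚ.<⇒≢ (ℚ.+-mono-< 0<l 0<l) (≡.sym l+l≡0))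
                            (ℚ.≮⇒≥ λ l<0 → ℚ.<⇒≢ (ℚ.+-mono-< l<0 l<0) l+l≡0)
    where
    -1#0 = neg#0 1#0
    l+l≡0 : log -1#0 ℚ.+ log -1#0 ≡ 0ℚ
    l+l≡0 = ≡.trans
      (≡.sym (proj₂ (≡p^-cong (solve 1 (λ x → :- x :* :- x := x :* x) refl 1#)
                              (≡p^-* (-1#0 , ≡.refl) (-1#0 , ≡.refl)))))
      (≡.trans (log-irrelevant _ _) (proj₂ (≡p^-* ∣1∣ ∣1∣)))

  -1*≈neg : ∀ x → - 1# * x ≈ - x
  -1*≈neg = RingProperties.-1*x≈-x ring

  ≡p^-neg : ∀ {x q} → ∣ x ∣≡p^ q → ∣ - x ∣≡p^ q
  ≡p^-neg {x} {q} ∣x∣ =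
    ≡p^-respʳ (ℚ.+-identityˡ q) (≡p^-cong (-1*≈neg x) (≡p^-* ∣-1∣ ∣x∣))

  ≤p^-neg : ∀ {x q} → ∣ x ∣≤p^ q → ∣ - x ∣≤p^ q
  ≤p^-neg {x} {q} ∣x∣ = ≤p^-respʳ (ℚ.+-identityˡ q)
    (≤p^-cong (-1*≈neg x) (≤p^-* (≡p^⇒≤p^ ∣-1∣) ∣x∣))

  ≤p^-sub : ∀ {x q} y z → ∣ x - y ∣≤p^ q → ∣ y - z ∣≤p^ q → ∣ x - z ∣≤p^ q
  ≤p^-sub {x} y z ∣x-y∣ ∣y-z∣ =
    ≤p^-cong (solve 3 (λ x y z → (x :- y) :+ (y :- z) := x :- z) refl x y z) (≤p^-+ ∣x-y∣ ∣y-z∣)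

  ≤p^-swap : ∀ x y {q} → ∣ x - y ∣≤p^ q → ∣ y - x ∣≤p^ q
  ≤p^-swap x y ∣x-y∣ = ≤p^-cong (solve 2 (λ x y → :- (x :- y) := y :- x) refl x y) (≤p^-neg ∣x-y∣)

  ≤p^-· : ∀ {x q} n → ∣ x ∣≤p^ q → ∣ n · x ∣≤p^ q
  ≤p^-· zero    ∣x∣≤ = ∣0∣≤p^ refl
  ≤p^-· (suc n) ∣x∣≤ = ≤p^-+ ∣x∣≤ (≤p^-· n ∣x∣≤)

  -- Both |x| ≤ |x + y| and |x + y| ≤ |x| come from the ultrametric inequality,
  -- the first one from x = (x + y) - y.
  ≡p^-+ˡ : ∀ {x y q} → ∣ x ∣≡p^ q → ∣ y ∣<p^ q → ∣ x + y ∣≡p^ q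
  ≡p^-+ˡ {x} {y} {q} (x#0 , ≡.refl) ∣y∣<
    with log-+ (#-congʳ (sym (//-rightDividesʳ y x)) x#0)
  ... | inj₂ (-y#0 , ≤log-y) = ⊥-elim (ℚ.<-irrefl ≡.refl (ℚ.≤-<-trans
    (ℚ.≤-trans (ℚ.≤-reflexive (log-cong (sym (//-rightDividesʳ y x)) _ _)) ≤log-y)
    (∣-y∣< -y#0)))
    where
    ∣-y∣< : ∣ - y ∣<p^ q
    ∣-y∣< -y#0 = ℚ.≤-<-trans (≡p^⇒≤p^ (≡p^-neg (y#0 , ≡.refl)) -y#0) (∣y∣< y#0)
      where y#0 = #-congʳ (solve 1 (λ y → :- (:- y) := y) refl y) (neg#0 -y#0)
  ... | inj₁ (x+y#0 , ≤log-x+y) = x+y#0 , ℚ.≤-antisym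
    (≤p^-+ (≡p^⇒≤p^ (x#0 , ≡.refl)) (λ y#0 → ℚ.<⇒≤ (∣y∣< y#0)) x+y#0)
    (ℚ.≤-trans (ℚ.≤-reflexive (log-cong (sym (//-rightDividesʳ y x)) _ _)) ≤log-x+y)

  ≡p^⇒<p^ : ∀ {x q r} → q ℚ.< r → ∣ x ∣≡p^ q → ∣ x ∣<p^ r
  ≡p^⇒<p^ q<r ∣x∣ x#0 = ℚ.≤-<-trans (≡p^⇒≤p^ ∣x∣ x#0) q<r

  ≤p^⇒<p^ : ∀ {x q r} → q ℚ.< r → ∣ x ∣≤p^ q → ∣ x ∣<p^ r
  ≤p^⇒<p^ q<r ∣x∣ x#0 = ℚ.≤-<-trans (∣x∣ x#0) q<r

-- Ultrametric convergence

neg-ℕ-antimono : ∀ {M N} → M ℕ.≤ N → ℚ.- (+ N / 1) ℚ.≤ ℚ.- (+ M / 1)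
neg-ℕ-antimono M≤N = ℚ.neg-antimono-≤ (/-mono-≤ 1 (ℤ.+≤+ M≤N))

strictly-decreasing⇒antitone : ∀ (g : ℕ → ℚ) → (∀ n → g (suc n) ℚ.< g n) →
                               ∀ {i j} → i ℕ.≤ j → g j ℚ.≤ g i
strictly-decreasing⇒antitone g g-dec {i} {j} i≤j =
  ≡.subst (λ j → g j ℚ.≤ g i) (ℕ.m∸n+n≡m i≤j) (shift (j ℕ.∸ i))
  where
  shift : ∀ k → g (k ℕ.+ i) ℚ.≤ g i
  shift zero    = ℚ.≤-refl
  shift (suc k) = ℚ.≤-trans (ℚ.<⇒≤ (g-dec (k ℕ.+ i))) (shift k)

module Convergence {c ℓ₁ ℓ₂} (V : ValuedField c ℓ₁ ℓ₂) where
  open ValuedField V hiding (zero)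
  open ValuedFieldProperties V
  open RingSolver commutativeRing

  -- By the ultrametric inequality, all terms from index N on stay within p^-N of the N-th, and the
  -- limit inherits this bound. The explicit rate is what the coefficients in `extension-complete`
  -- need.
  geometric-limit : IsComplete → ∀ x → (∀ N → ∣ x (suc N) - x N ∣≤p^- N) →
                    ∃[ α ] ∀ N → ∣ x N - α ∣≤p^- N
  geometric-limit complete x step = α , λ N → let (M , x-α) = x⟶α N in
    ≤p^-sub (x (M ℕ.⊔ N)) α
      (close N N (M ℕ.⊔ N) ℕ.≤-refl (ℕ.m≤n⊔m M N)) (x-α (M ℕ.⊔ N) (ℕ.m≤m⊔n M N))
    where
    ahead : ∀ N k → ∣ x (k ℕ.+ N) - x N ∣≤p^- N
    ahead N zero    = ∣0∣≤p^ (-‿inverseʳ (x N))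
    ahead N (suc k) = ≤p^-sub (x (k ℕ.+ N)) (x N)
      (≤p^-weaken (neg-ℕ-antimono (ℕ.m≤n+m N k)) (step (k ℕ.+ N))) (ahead N k)
    ahead≤ : ∀ N i → N ℕ.≤ i → ∣ x i - x N ∣≤p^- N
    ahead≤ N i N≤i = ≡.subst (λ i → ∣ x i - x N ∣≤p^- N) (ℕ.m∸n+n≡m N≤i) (ahead N (i ℕ.∸ N))
    close : ∀ N i j → N ℕ.≤ i → N ℕ.≤ j → ∣ x i - x j ∣≤p^- N
    close N i j N≤i N≤j =
      ≤p^-sub (x N) (x j) (ahead≤ N i N≤i) (≤p^-swap (x j) (x N) (ahead≤ N j N≤j))
    limit = complete x λ N → N , close N
    α = proj₁ limit
    x⟶α = proj₂ limit

  module StrictlyDecreasingSteps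
    (x : ℕ → Carrier) (g : ℕ → ℚ) (g-dec : ∀ n → g (suc n) ℚ.< g n)
    (∣step∣ : ∀ n → ∣ x (suc n) - x n ∣≡p^ g n) where

    -- The first step, from n to n + 1, dominates: by induction on k, the remaining distance from
    -- `x (suc n)` has the strictly smaller exponent `g (suc n)`.
    ∣x[k+1+n]-xₙ∣ : ∀ k n → ∣ x (k ℕ.+ suc n) - x n ∣≡p^ g n
    ∣x[k+1+n]-xₙ∣ zero    n = ∣step∣ n
    ∣x[k+1+n]-xₙ∣ (suc k) n = ≡.subst (λ j → ∣ x j - x n ∣≡p^ g n) (ℕ.+-suc k (suc n))
      (≡p^-cong (solve 3 (λ a b c → (b :- c) :+ (a :- b) := a :- c) refl _ (x (suc n)) (x n))
        (≡p^-+ˡ (∣step∣ n) (≡p^⇒<p^ (g-dec n) (∣x[k+1+n]-xₙ∣ k (suc n)))))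

    ∣xⱼ-xᵢ∣ : ∀ {i j} → i ℕ.< j → ∣ x j - x i ∣≡p^ g i
    ∣xⱼ-xᵢ∣ {i} {j} i<j = ≡.subst (λ j → ∣ x j - x i ∣≡p^ g i) (ℕ.m∸n+n≡m i<j)
      (∣x[k+1+n]-xₙ∣ (j ℕ.∸ suc i) i)

    ∣xᵢ-xⱼ∣≤ : ∀ M i j → M ℕ.≤ i → M ℕ.≤ j → ∣ x i - x j ∣≤p^ g M
    ∣xᵢ-xⱼ∣≤ M i j M≤i M≤j with ℕ.<-cmp i j
    ... | tri≈ _ ≡.refl _ = ∣0∣≤p^ (-‿inverseʳ (x i))
    ... | tri> _ _ j<i = ≤p^-weaken (strictly-decreasing⇒antitone g g-dec M≤j) (≡p^⇒≤p^ (∣xⱼ-xᵢ∣ j<i))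
    ... | tri< i<j _ _ = ≤p^-swap (x j) (x i)
      (≤p^-weaken (strictly-decreasing⇒antitone g g-dec M≤i) (≡p^⇒≤p^ (∣xⱼ-xᵢ∣ i<j)))

    limit : IsComplete → (∀ N → ∃[ M ] g M ℚ.≤ ℚ.- (+ N / 1)) →
            ∃[ α ] (x ⟶ α) × ∀ n → ∣ α - x n ∣≡p^ g n
    limit complete g→-∞ = α , x⟶α , ∣α-xₙ∣
      where
      cauchy : IsCauchy x
      cauchy N = let (M , gM≤) = g→-∞ N in
        M , λ i j M≤i M≤j → ≤p^-weaken gM≤ (∣xᵢ-xⱼ∣≤ M i j M≤i M≤j)
      α = proj₁ (complete x cauchy)
      x⟶α = proj₂ (complete x cauchy)
      ∣α-xₙ∣ : ∀ n → ∣ α - x n ∣≡p^ g n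
      ∣α-xₙ∣ n =
        -- Choose p^-N below the claimed distance, and a term `x i` that is this close to α and
        -- comes after `x n`. In α - xₙ = (xᵢ - xₙ) + (α - xᵢ) the first summand then dominates.
        let N , -N<gn = archimedean (g n)
            M , ∣x-α∣≤ = x⟶α N
            i = M ℕ.⊔ suc n
        in ≡p^-cong (solve 3 (λ a b c → (b :- c) :+ (a :- b) := a :- c) refl α (x i) (x n))
             (≡p^-+ˡ (∣xⱼ-xᵢ∣ (ℕ.m≤n⊔m M (suc n)))
               (≤p^⇒<p^ -N<gn (≤p^-swap (x i) α (∣x-α∣≤ i (ℕ.m≤m⊔n M (suc n))))))

-- Continued fractions and their convergents

module ContinuedFractions {c ℓ₁ ℓ₂} (V : ValuedField c ℓ₁ ℓ₂) where
  open ValuedField V hiding (zero)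
  open ValuedFieldProperties V
  open RingSolver commutativeRing

  -- Both sides obey the same three-term recurrence. Together with `numerator-shift` this splits off
  -- the first partial quotient: `ContinuedFraction` recurses at the front, `numerator` and
  -- `denominator` at the back.
  denominator-shift : ∀ a n → denominator a (suc n) ≈ numerator (a ∘ suc) n
  denominator-shift a 0             = refl
  denominator-shift a 1             = +-congʳ (*-comm _ _)
  denominator-shift a (suc (suc n)) =
    +-cong (*-congˡ (denominator-shift a (suc n))) (denominator-shift a n)

  numerator-shift : ∀ a n → numerator a (suc n) ≈
                            a 0 * numerator (a ∘ suc) n + denominator (a ∘ suc) n
  numerator-shift a 0             = refl
  -- The solver sees `1#` as a variable `o`, so a factor `1#` is inserted beforehand to make both
  -- sides homogeneous, and one is removed afterwards.
  numerator-shift a 1             = trans (+-congˡ (sym (*-identityʳ _))) (trans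
    (solve 4 (λ x y z o → z :* (x :* y :+ o) :+ x :* o := x :* (y :* z :+ o) :+ z :* o)
      refl (a 0) (a 1) (a 2) 1#)
    (+-congˡ (*-identityʳ _)))
  numerator-shift a (suc (suc n)) = trans
    (+-cong (*-congˡ (numerator-shift a (suc n))) (numerator-shift a n))
    (solve 6 (λ x c s₁ t₁ s₀ t₀ → c :* (x :* s₁ :+ t₁) :+ (x :* s₀ :+ t₀) :=
                                  x :* (c :* s₁ :+ s₀) :+ (c :* t₁ :+ t₀))
      refl (a 0) (a (suc (suc (suc n)))) _ _ _ _)

  -- The determinant is 1 for n = 0 and changes sign at every step. Only its absolute value is
  -- recorded, so no sign has to be tracked.
  ∣determinant∣ : ∀ a n → ∣ numerator a (suc n) * denominator a n
                          - numerator a n * denominator a (suc n) ∣≡p^ 0ℚ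
  ∣determinant∣ a zero    = ≡p^-cong (trans
    (solve 3 (λ x y o → o := x :* y :+ o :- x :* y) refl (a 0) (a 1) 1#)
    (+-congʳ (sym (*-identityʳ _)))) ∣1∣
  ∣determinant∣ a (suc n) = ≡p^-cong
    (solve 5 (λ c s₁ t₁ s₀ t₀ → :- (s₁ :* t₀ :- s₀ :* t₁) :=
                                (c :* s₁ :+ s₀) :* t₁ :- s₁ :* (c :* t₁ :+ t₀))
      refl (a (suc (suc n))) _ _ _ _)
    (≡p^-neg (∣determinant∣ a n))

  module Convergents (a : ℕ → Carrier) (∣a∣>1 : ∀ n → ∣ a (suc n) ∣>1) where
    private
      s = numerator a
      t = denominator a

    -- The index is shifted: this is the exponent of `a (suc n)`, because `a 0` need not exceed 1 in
    -- absolute value.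
    log-a : ℕ → ℚ
    log-a n = log (proj₁ (∣a∣>1 n))

    -- Apartness from zero and size have to be proved together. In the recurrence for tₙ₊₂ the
    -- product aₙ₊₂ tₙ₊₁ dominates, as |tₙ| < |tₙ₊₁| < |aₙ₊₂ tₙ₊₁|; this dominance gives both the
    -- size of tₙ₊₂ and its apartness from zero.
    growth : ∀ n → Σ[ t#0 ∈ t n # 0# ] ∣ t (suc n) ∣≡p^ (log-a n ℚ.+ log t#0)
    growth zero    = 1#0 , ≡p^-respʳ
      (≡.sym (≡.trans (≡.cong (log-a 0 ℚ.+_) (proj₂ ∣1∣)) (ℚ.+-identityʳ (log-a 0))))
      (proj₁ (∣a∣>1 0) , ≡.refl)
    growth (suc n) = let (tₙ#0 , tₙ₊₁#0 , log≡) = growth n in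
      tₙ₊₁#0 , ≡p^-+ˡ (≡p^-* (proj₁ (∣a∣>1 (suc n)) , ≡.refl) (tₙ₊₁#0 , ≡.refl))
        (≡p^⇒<p^ (ℚ.<-trans (≡.subst (log tₙ#0 ℚ.<_) (≡.sym log≡) (q<r+q (proj₂ (∣a∣>1 n))))
                            (q<r+q (proj₂ (∣a∣>1 (suc n)))))
          (tₙ#0 , ≡.refl))
      where
      q<r+q : ∀ {q r} → 0ℚ ℚ.< r → q ℚ.< r ℚ.+ q
      q<r+q {q} {r} 0<r = ≡.subst (ℚ._< r ℚ.+ q) (ℚ.+-identityˡ q) (ℚ.+-monoˡ-< q 0<r)

    t#0 : ∀ n → t n # 0#
    t#0 n = proj₁ (growth n)

    log-t : ℕ → ℚ
    log-t n = log (t#0 n)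

    log-t-suc : ∀ n → log-t (suc n) ≡ log-a n ℚ.+ log-t n
    log-t-suc n = proj₂ (proj₂ (growth n))

    log-t-increasing : ∀ n → log-t n ℚ.< log-t (suc n)
    log-t-increasing n = ≡.subst₂ ℚ._<_ (ℚ.+-identityˡ _) (≡.sym (log-t-suc n))
      (ℚ.+-monoˡ-< (log-t n) (proj₂ (∣a∣>1 n)))

    -- The exponent of 1 / (|tₙ| |tₙ₊₁|).
    gap : ℕ → ℚ
    gap n = ℚ.- (log-t n ℚ.+ log-t (suc n))

    gap-decreasing : ∀ n → gap (suc n) ℚ.< gap n
    gap-decreasing n = ℚ.neg-antimono-< (ℚ.+-mono-< (log-t-increasing n) (log-t-increasing (suc n)))

    ∣convergent-step∣ : ∀ n → ∣ s (suc n) ÷ t#0 (suc n) - s n ÷ t#0 n ∣≡p^ gap n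
    ∣convergent-step∣ n = ≡p^-respʳ log≡ (≡p^-cong difference
      (≡p^-* (≡p^-* (∣determinant∣ a n) (≡p^-⁻¹ (t#0 n) (t#0 n , ≡.refl)))
             (≡p^-⁻¹ (t#0 (suc n)) (t#0 (suc n) , ≡.refl))))
      where
      log≡ : 0ℚ ℚ.+ (ℚ.- log-t n) ℚ.+ (ℚ.- log-t (suc n)) ≡ gap n
      log≡ = ≡.trans (≡.cong (ℚ._+ (ℚ.- log-t (suc n))) (ℚ.+-identityˡ (ℚ.- log-t n)))
                     (≡.sym (ℚ.neg-distrib-+ (log-t n) (log-t (suc n))))
      open SetoidReasoning setoid
      s₀ = s n
      t₀ = t n
      i₀ = t#0 n ⁻¹
      s₁ = s (suc n)
      t₁ = t (suc n)
      i₁ = t#0 (suc n) ⁻¹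
      difference : (s₁ * t₀ - s₀ * t₁) * i₀ * i₁ ≈ s₁ * i₁ - s₀ * i₀
      difference = begin
        (s₁ * t₀ - s₀ * t₁) * i₀ * i₁
          ≈⟨ solve 6 (λ s₁ t₁ i₁ s₀ t₀ i₀ → (s₁ :* t₀ :- s₀ :* t₁) :* i₀ :* i₁ :=
                                            s₁ :* i₁ :* (t₀ :* i₀) :- s₀ :* i₀ :* (t₁ :* i₁))
               refl s₁ t₁ i₁ s₀ t₀ i₀ ⟩
        s₁ * i₁ * (t₀ * i₀) - s₀ * i₀ * (t₁ * i₁)
          ≈⟨ +-cong (*-congˡ (⁻¹-inverseʳ (t#0 n))) (-‿cong (*-congˡ (⁻¹-inverseʳ (t#0 (suc n))))) ⟩
        s₁ * i₁ * 1# - s₀ * i₀ * 1#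
          ≈⟨ +-cong (*-identityʳ _) (-‿cong (*-identityʳ _)) ⟩
        s₁ * i₁ - s₀ * i₀ ∎

    module _ (e : ℕ) .{{_ : NonZero e}} (1/e≤log-a : ∀ n → + 1 / e ℚ.≤ log-a n) where

      -- Strict growth alone would not make |tₙ| unbounded; the uniform factor p^(1/e) per step
      -- does.
      n/e≤log-t : ∀ n → + n / e ℚ.≤ log-t n
      n/e≤log-t zero    = ℚ.≤-reflexive (≡.trans (ℚ.0/n≡0 e) (≡.sym (proj₂ ∣1∣)))
      n/e≤log-t (suc n) = ≡.subst₂ ℚ._≤_ (/-homo-+ (+ 1) (+ n) e) (≡.sym (log-t-suc n))
        (ℚ.+-mono-≤ (1/e≤log-a n) (n/e≤log-t n))

      gap-unbounded : ∀ N → ∃[ M ] gap M ℚ.≤ ℚ.- (+ N / 1)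
      gap-unbounded N = M , ℚ.neg-antimono-≤ (begin
        + N / 1                        ≡⟨ *-cancel-/ (+ N) e ⟨
        (+ N ℤ.* + e) / e              ≡⟨ ≡.cong (_/ e) (ℤ.pos-* N e) ⟨
        + M / e                        ≤⟨ n/e≤log-t M ⟩
        log-t M                        ≡⟨ ℚ.+-identityʳ (log-t M) ⟨
        log-t M ℚ.+ 0ℚ                 ≤⟨ ℚ.+-monoʳ-≤ (log-t M) (ℚ.≤-trans 0≤ (n/e≤log-t (suc M))) ⟩
        log-t M ℚ.+ log-t (suc M)      ∎)
        where
        open ℚ.≤-Reasoning
        -- After N e steps |t| has reached p^N. The second factor `t (suc M)` only has to be at
        -- least 1 in absolute value.
        M = N ℕ.* e
        0≤ : 0ℚ ℚ.≤ + suc M / e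
        0≤ = ℚ.≤-trans (ℚ.≤-reflexive (≡.sym (ℚ.0/n≡0 e))) (/-mono-≤ e (ℤ.+≤+ (ℕ.z≤n {suc M})))

      convergence : IsComplete → ∃[ α ] ((λ n → s n ÷ t#0 n) ⟶ α) ×
                                        ∀ n → ∣ α - s n ÷ t#0 n ∣≡p^ gap n
      convergence complete = Convergence.StrictlyDecreasingSteps.limit V _ gap gap-decreasing
        ∣convergent-step∣ complete gap-unbounded

  -- Induction through the tail `a ∘ suc` with value y = s′ / t′. The shift lemmas turn the
  -- convergent into (a₀ s′ + t′) / s′ = a₀ + 1 / y. The bounds |a| > 1 make the denominators of the
  -- tails invertible too.
  continuedFraction : ∀ a → (∀ n → ∣ a (suc n) ∣>1) → ∀ n (t#0 : denominator a n # 0#) →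
                      ContinuedFraction a n (numerator a n ÷ t#0)
  continuedFraction a ∣a∣>1 zero t#0 = lift (begin
    a 0 * t#0 ⁻¹         ≈⟨ *-congˡ (*-identityˡ _) ⟨
    a 0 * (1# * t#0 ⁻¹)  ≈⟨ *-congˡ (⁻¹-inverseʳ t#0) ⟩
    a 0 * 1#             ≈⟨ *-identityʳ (a 0) ⟩
    a 0                  ∎)
    where open SetoidReasoning setoid
  continuedFraction a ∣a∣>1 (suc n) t#0 =
    y , continuedFraction (a ∘ suc) (∣a∣>1 ∘ suc) n t′#0 , y#0 , (begin
      numerator a (suc n) * i      ≈⟨ *-congʳ (numerator-shift a n) ⟩
      (a 0 * s′ + t′) * i          ≈⟨ solve 4 (λ x s t i →
                                        (x :* s :+ t) :* i := x :* (s :* i) :+ t :* i)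
                                        refl (a 0) s′ t′ i ⟩
      a 0 * (s′ * i) + t′ * i      ≈⟨ +-cong (trans (*-congˡ s′i≈1) (*-identityʳ (a 0)))
                                             (sym (⁻¹-unique y#0 y[t′i]≈1)) ⟩
      a 0 + y#0 ⁻¹                 ∎)
    where
    open SetoidReasoning setoid
    s′ = numerator (a ∘ suc) n
    t′ = denominator (a ∘ suc) n
    t′#0 = Convergents.t#0 (a ∘ suc) (∣a∣>1 ∘ suc) n
    i = t#0 ⁻¹
    y = s′ ÷ t′#0
    -- The denominator of the whole fraction is s′, so `i` inverts s′, and t′ i inverts y.
    s′i≈1 : s′ * i ≈ 1#
    s′i≈1 = trans (*-congʳ (sym (denominator-shift a n))) (⁻¹-inverseʳ t#0)
    y[t′i]≈1 : y * (t′ * i) ≈ 1#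
    y[t′i]≈1 = begin
      s′ * t′#0 ⁻¹ * (t′ * i)    ≈⟨ solve 4 (λ s j t i → s :* j :* (t :* i) := (s :* i) :* (t :* j))
                                      refl s′ (t′#0 ⁻¹) t′ i ⟩
      (s′ * i) * (t′ * t′#0 ⁻¹)  ≈⟨ *-cong s′i≈1 (⁻¹-inverseʳ t′#0) ⟩
      1# * 1#                    ≈⟨ *-identityˡ 1# ⟩
      1#                         ∎
    y#0 = *≈1⇒#0 y[t′i]≈1

-- Finite sums and completeness of extensions

module _ {c ℓ} (M : Monoid c ℓ) where
  open Monoid M
  open MonoidSum M

  sum-++ : ∀ {m n} (x : Fin m → Carrier) (y : Fin n → Carrier) → sum (x ++ y) ≈ sum x ∙ sum y
  sum-++ {zero}  x y = sym (identityˡ (sum y))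
  sum-++ {suc m} x y = trans
    (∙-congˡ (trans (reflexive (sum-cong-≗ tail-++)) (sum-++ (x ∘ suc) y)))
    (sym (assoc (x zero) (sum (x ∘ suc)) (sum y)))
    where
    tail-++ : ∀ i → (x ++ y) (suc i) ≡ ((x ∘ suc) ++ y) i
    tail-++ i with splitAt m i
    ... | inj₁ _ = ≡.refl
    ... | inj₂ _ = ≡.refl

module ExtensionProperties
  {c ℓ₁ ℓ₂ c′ ℓ₁′ ℓ₂′} {F : ValuedField c ℓ₁ ℓ₂} {K : ValuedField c′ ℓ₁′ ℓ₂′}
  (E : Extension F K) where
  private
    module F = ValuedField F
    module FP = ValuedFieldProperties F
  open ValuedField K hiding (zero)
  open ValuedFieldProperties K
  open RingSolver commutativeRing
  open Extension E
  open RingMorphisms F.rawRing rawRing using (module IsRingHomomorphism)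
  open IsRingHomomorphism isRingHomomorphism
  open SemiringSum semiring using (sum-cong-≋; ∑-distrib-+; *-distribˡ-sum)
  open SetoidReasoning setoid

  embed-≡p^ : ∀ {x q} → F.∣ x ∣≡p^ q → ∣ embed x ∣≡p^ q
  embed-≡p^ = Equivalence.to (isometric _ _)

  -- `isometric` speaks of exact values only. Apartness of `embed x` from zero supplies one, which
  -- is then pulled back to x.
  embed-≤p^ : ∀ {x q} → F.∣ x ∣≤p^ q → ∣ embed x ∣≤p^ q
  embed-≤p^ ∣x∣≤ embed-x#0 =
    let x#0 , log≡ = Equivalence.from (isometric _ _) (embed-x#0 , ≡.refl) in
    ℚ.≤-trans (ℚ.≤-reflexive (≡.sym log≡)) (∣x∣≤ x#0)

  embed-n·1 : ∀ n x → embed (n F.· F.1#) * x ≈ n · x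
  embed-n·1 zero    x = trans (*-congʳ 0#-homo) (zeroˡ x)
  embed-n·1 (suc n) x = begin
    embed (F.1# F.+ n F.· F.1#) * x           ≈⟨ *-congʳ (+-homo _ _) ⟩
    (embed F.1# + embed (n F.· F.1#)) * x     ≈⟨ distribʳ x _ _ ⟩
    embed F.1# * x + embed (n F.· F.1#) * x   ≈⟨ +-cong (trans (*-congʳ 1#-homo) (*-identityˡ x))
                                                         (embed-n·1 n x) ⟩
    x + n · x                                 ∎

  combination : ∀ {n} → (Fin n → Carrier) → (Fin n → F.Carrier) → Carrier
  combination w q = sum λ i → embed (q i) * w i

  combination-0 : ∀ {n} (w : Fin n → Carrier) → combination w (λ _ → F.0#) ≈ 0#
  combination-0 {zero}  w = refl
  combination-0 {suc n} w = trans
    (+-cong (trans (*-congʳ 0#-homo) (zeroˡ (w zero))) (combination-0 (w ∘ suc))) (+-identityˡ 0#)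

  -- The effect of appending one digit to every coefficient; `b` will be a power of the uniformizer.
  combination-update : ∀ {n} (w : Fin n → Carrier) q b (d : Fin n → ℕ) →
    combination w (λ i → q i F.+ b F.* (d i F.· F.1#)) ≈
    combination w q + embed b * sum (λ i → d i · w i)
  combination-update w q b d = begin
    sum (λ i → embed (q i F.+ b F.* (d i F.· F.1#)) * w i)
      ≈⟨ sum-cong-≋ (λ i → pointwise (q i) (d i) (w i)) ⟩
    sum (λ i → embed (q i) * w i + embed b * (d i · w i))
      ≈⟨ ∑-distrib-+ (λ i → embed (q i) * w i) (λ i → embed b * (d i · w i)) ⟩
    combination w q + sum (λ i → embed b * (d i · w i))
      ≈⟨ +-congˡ (*-distribˡ-sum (embed b) (λ i → d i · w i)) ⟨
    combination w q + embed b * sum (λ i → d i · w i) ∎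
    where
    pointwise : ∀ q n x → embed (q F.+ b F.* (n F.· F.1#)) * x ≈ embed q * x + embed b * (n · x)
    pointwise q n x = begin
      embed (q F.+ b F.* (n F.· F.1#)) * x                  ≈⟨ *-congʳ (+-homo _ _) ⟩
      (embed q + embed (b F.* (n F.· F.1#))) * x            ≈⟨ distribʳ x _ _ ⟩
      embed q * x + embed (b F.* (n F.· F.1#)) * x          ≈⟨ +-congˡ (*-congʳ (*-homo b _)) ⟩
      embed q * x + embed b * embed (n F.· F.1#) * x        ≈⟨ +-congˡ (*-assoc (embed b) _ x) ⟩
      embed q * x + embed b * (embed (n F.· F.1#) * x)      ≈⟨ +-congˡ (*-congˡ (embed-n·1 n x)) ⟩
      embed q * x + embed b * (n · x)                       ∎

  -- The ultrametric inequality, with each |wᵢ| ≤ 1. It carries convergence of the coefficients over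
  -- to the combinations.
  combination-≤p^ : ∀ {n r} (w : Fin n → Carrier) (q q′ : Fin n → F.Carrier) → (∀ i → ∣ w i ∣≤p^ 0ℚ) →
    (∀ i → F.∣ q i F.- q′ i ∣≤p^ r) → ∣ combination w q - combination w q′ ∣≤p^ r
  combination-≤p^ {zero}  w q q′ ∣w∣≤1 ∣q-q′∣≤ = ∣0∣≤p^ (-‿inverseʳ 0#)
  combination-≤p^ {suc n} {r} w q q′ ∣w∣≤1 ∣q-q′∣≤ = ≤p^-cong
    (trans (+-congʳ (*-congʳ (trans (+-homo _ _) (+-congˡ (-‿homo _)))))
      (solve 5 (λ a b w x y → (a :- b) :* w :+ (x :- y) := (a :* w :+ x) :- (b :* w :+ y))
        refl (embed (q zero)) (embed (q′ zero)) (w zero) _ _))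
    (≤p^-+ (≤p^-respʳ (ℚ.+-identityʳ r) (≤p^-* (embed-≤p^ (∣q-q′∣≤ zero)) (∣w∣≤1 zero)))
           (combination-≤p^ (w ∘ suc) (q ∘ suc) (q′ ∘ suc) (∣w∣≤1 ∘ suc) (∣q-q′∣≤ ∘ suc)))

  -- A limit of x is x₀ plus a combination built digit by digit: dividing the current error by
  -- bᴺ and approximating the quotient modulo b yields the N-th digit of every
  -- coefficient, and the coefficients converge because F is complete.
  module _ (complete : F.IsComplete) {b : F.Carrier} (∣b∣ : F.∣ b ∣≡p^ (ℚ.- (+ 1 / 1)))
    {n : ℕ} (w : Fin n → Carrier) (∣w∣≤1 : ∀ i → ∣ w i ∣≤p^ 0ℚ)
    (approximate : ∀ x → ∣ x ∣≤p^ 0ℚ → Σ[ d ∈ (Fin n → ℕ) ] ∣ x - sum (λ i → d i · w i) ∣≤p^- 1) where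

    -1-N : ∀ N → ℚ.- (+ 1 / 1) ℚ.+ ℚ.- (+ N / 1) ≡ ℚ.- (+ suc N / 1)
    -1-N N = ≡.trans (≡.sym (ℚ.neg-distrib-+ (+ 1 / 1) (+ N / 1)))
                     (≡.cong ℚ.-_ (/-homo-+ (+ 1) (+ N) 1))

    ∣b^N∣ : ∀ N → F.∣ b F.^ N ∣≡p^ (ℚ.- (+ N / 1))
    ∣b^N∣ zero    = FP.∣1∣
    ∣b^N∣ (suc N) = FP.≡p^-respʳ (-1-N N) (FP.≡p^-* ∣b∣ (∣b^N∣ N))

    refine : ∀ N x → ∣ x ∣≤p^- N →
      Σ[ d ∈ (Fin n → ℕ) ] ∣ x - embed (b F.^ N) * sum (λ i → d i · w i) ∣≤p^- suc N
    refine N x ∣x∣≤ = d , ≤p^-cong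
      (begin
        B * (x * B⁻¹ - D)      ≈⟨ solve 4 (λ b x i d → b :* (x :* i :- d) := x :* (b :* i) :- b :* d)
                                    refl B x B⁻¹ D ⟩
        x * (B * B⁻¹) - B * D  ≈⟨ +-congʳ (trans (*-congˡ (⁻¹-inverseʳ B#0)) (*-identityʳ x)) ⟩
        x - B * D              ∎)
      (≤p^-respʳ (≡.trans (ℚ.+-comm (ℚ.- (+ N / 1)) (ℚ.- (+ 1 / 1))) (-1-N N))
        (≤p^-* (≡p^⇒≤p^ ∣B∣) ∣rest∣))
      where
      B = embed (b F.^ N)
      ∣B∣ = embed-≡p^ (∣b^N∣ N)
      B#0 = proj₁ ∣B∣
      B⁻¹ = B#0 ⁻¹
      quotient-≤1 : ∣ x * B⁻¹ ∣≤p^ 0ℚ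
      quotient-≤1 = ≤p^-respʳ (ℚ.+-inverseʳ (ℚ.- (+ N / 1)))
        (≤p^-* ∣x∣≤ (≡p^⇒≤p^ (≡p^-⁻¹ B#0 ∣B∣)))
      d = proj₁ (approximate (x * B⁻¹) quotient-≤1)
      D = sum λ i → d i · w i
      ∣rest∣ = proj₂ (approximate (x * B⁻¹) quotient-≤1)

    extension-complete : IsComplete
    extension-complete x cauchy = x₀ + combination w q , λ N → M N , λ i M≤i →
      ≤p^-sub (x₀ + combination w (coefficients N)) _ (error N i M≤i)
        (≤p^-cong (solve 3 (λ a s t → s :- t := (a :+ s) :- (a :+ t)) refl x₀ _ _)
          (combination-≤p^ w _ _ ∣w∣≤1 λ i → proj₂ (limits i) N))
      where
      M : ℕ → ℕ
      M N = proj₁ (cauchy N)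
      -- Subtracting this term leaves errors of absolute value at most 1, so the expansion can start
      -- at digit 0.
      x₀ = x (M 0)
      Approximation : ℕ → (Fin n → F.Carrier) → Set _
      Approximation N q = ∀ i → M N ℕ.≤ i → ∣ x i - (x₀ + combination w q) ∣≤p^- N

      next : ∀ N {q} → Approximation N q →
             Σ[ d ∈ (Fin n → ℕ) ] Approximation (suc N) (λ i → q i F.+ b F.^ N F.* (d i F.· F.1#))
      next N {q} approx = d , λ i M≤i → ≤p^-sub (x m) _
        (proj₂ (cauchy (suc N)) i m M≤i (ℕ.m≤n⊔m (M N) (M (suc N))))
        (≤p^-cong (trans
          (solve 4 (λ x a s t → (x :- (a :+ s)) :- t := x :- (a :+ (s :+ t))) refl (x m) x₀ _ _)
          (+-congˡ (-‿cong (+-congˡ (sym (combination-update w q (b F.^ N) d)))))) (proj₂ digit))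
        where
        -- Beyond `M N` the current error is at most p^-N, as `refine` requires; beyond `M (suc N)`
        -- the single term `x m` stands for all later terms up to p^-(N+1).
        m = M N ℕ.⊔ M (suc N)
        digit = refine N (x m - (x₀ + combination w q)) (approx m (ℕ.m≤m⊔n (M N) (M (suc N))))
        d = proj₁ digit

      approximation : ∀ N → ∃[ q ] Approximation N q
      approximation zero    = (λ _ → F.0#) , λ i M≤i → ≤p^-cong
        (+-congˡ (-‿cong (sym (trans (+-congˡ (combination-0 w)) (+-identityʳ x₀)))))
        (proj₂ (cauchy 0) i (M 0) M≤i ℕ.≤-refl)
      approximation (suc N) = _ , proj₂ (next N (proj₂ (approximation N)))

      coefficients : ℕ → Fin n → F.Carrier
      coefficients N = proj₁ (approximation N)
      error = λ N → proj₂ (approximation N)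

      -- The two coefficients differ by bᴺ times a natural number, and natural numbers have absolute
      -- value at most 1.
      ∣coefficient-step∣ : ∀ i N → F.∣ coefficients (suc N) i F.- coefficients N i ∣≤p^- N
      ∣coefficient-step∣ i N = FP.≤p^-cong
        (F.sym (FP.xyx⁻¹≈y (coefficients N i) _))
        (FP.≤p^-respʳ (ℚ.+-identityʳ _)
          (FP.≤p^-* (FP.≡p^⇒≤p^ (∣b^N∣ N)) (FP.≤p^-· (digits i) (FP.≡p^⇒≤p^ FP.∣1∣))))
        where
        digits = proj₁ (next N (proj₂ (approximation N)))

      limits = λ i → Convergence.geometric-limit F complete
        (λ N → coefficients N i) (∣coefficient-step∣ i)
      q : Fin n → F.Carrier
      q i = proj₁ (limits i)

-- The uniformizer p of ℚₚ

exactPower-self : ∀ {p} → 1 ℕ.< p → ExactPower p 1 p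
exactPower-self {p@(suc _)} 1<p = ∣-reflexive (ℕ.*-identityʳ p) , λ p²∣p →
  ℕ.<⇒≱ (≡.subst₂ ℕ._<_ (ℕ.*-identityʳ p) (≡.cong (p ℕ.*_) (≡.sym (ℕ.*-identityʳ p)))
                        (ℕ.*-monoʳ-< p 1<p))
        (∣⇒≤ p²∣p)

exactPower-one : ∀ {p} → 1 ℕ.< p → ExactPower p 0 1
exactPower-one {p} 1<p = ∣-refl , λ p∣1 →
  ℕ.<-irrefl (≡.trans (≡.sym (∣1⇒≡1 p∣1)) (ℕ.*-identityʳ p)) 1<p

module _ {c ℓ₁ ℓ₂} {p : ℕ} {Qp : ValuedField c ℓ₁ ℓ₂} (isQp : IsPadicNumbers p Qp)
         (1<p : 1 ℕ.< p) where
  open ValuedField Qp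
  open IsPadicNumbers isQp

  ∃uniformizer : ∃[ π ] ∣ π ∣≡p^ (-ℚ (+ 1 / 1))
  ∃uniformizer = fromℚ p/1 , isometric p/1 {1} {0} (exactPower-self 1<p) (exactPower-one 1<p)
    -- Built directly in lowest terms, so that its numerator and denominator compute to p and 1 for
    -- `isometric`.
    where p/1 = mkℚ (+ p) 0 (coprime-sym (1-coprimeTo p))

-- Approximating the integers of K modulo p

module DigitExpansion {c ℓ₁ ℓ₂} (K : ValuedField c ℓ₁ ℓ₂) (e : ℕ) .{{_ : NonZero e}} {p f : ℕ}
  (ramification : ValuedField.HasRamificationIndex K U e)
  (residue : ValuedField.HasResidueDegree K p f) where
  open ValuedField K hiding (zero)
  open ValuedFieldProperties K
  open RingSolver commutativeRing
  open SemiringSum semiring using (sum-cong-≋; sum-cong-≗; *-distribˡ-sum)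
  open Mult semiring using (×-comm-*)
  open SetoidReasoning setoid

  -- An element of value p^(-k/e) is picked for each k separately, instead of powers of one
  -- uniformizer; only the values matter.
  ϖ : ℕ → Carrier
  ϖ k = proj₁ (proj₂ ramification (ℤ.- (+ k)))

  ∣ϖ∣ : ∀ k → ∣ ϖ k ∣≡p^ (ℤ.- (+ k) / e)
  ∣ϖ∣ k = proj₂ (proj₂ (proj₂ ramification (ℤ.- (+ k))))

  private
    u : Fin f → Carrier
    u = proj₁ residue

  -- Dividing by `ϖ k` gives an integer, which the residue basis approximates with an error below 1.
  -- As the value group is discrete, that error is at most p^(-1/e), and multiplying back gains one
  -- step.
  leading-digits : ∀ k x → ∣ x ∣≤p^ (ℤ.- (+ k) / e) →
    Σ[ a ∈ (Fin f → Fin p) ] ∣ x - sum (λ i → toℕ (a i) · (ϖ k * u i)) ∣≤p^ (ℤ.- (+ suc k) / e)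
  leading-digits k x ∣x∣≤ =
    a , ≤p^-cong rearranged (≤p^-respʳ exponent (≤p^-* (≡p^⇒≤p^ (∣ϖ∣ k)) ∣rest∣≤))
    where
    ϖ#0 = proj₁ (∣ϖ∣ k)
    y = x ÷ ϖ#0
    ∣y∣≤1 : ∣ y ∣≤p^ 0ℚ
    ∣y∣≤1 = ≤p^-respʳ (ℚ.+-inverseʳ (ℤ.- (+ k) / e)) (≤p^-* ∣x∣≤ (≡p^⇒≤p^ (≡p^-⁻¹ ϖ#0 (∣ϖ∣ k))))
    nearest = proj₁ (proj₂ (proj₂ residue)) y ∣y∣≤1
    a = proj₁ nearest
    rest = y - sum (λ i → toℕ (a i) · u i)
    ∣rest∣≤ : ∣ rest ∣≤p^ (ℤ.- (+ 1) / e)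
    ∣rest∣≤ rest#0 = let j , log≡j/e = proj₁ ramification _ rest#0 in
      ℚ.≤-trans (ℚ.≤-reflexive log≡j/e)
        (/-negative⇒≤-1/ e j (≡.subst (ℚ._< 0ℚ) log≡j/e (proj₂ nearest rest#0)))
    exponent : ℤ.- (+ k) / e +ℚ ℤ.- (+ 1) / e ≡ ℤ.- (+ suc k) / e
    exponent = ≡.trans (/-homo-+ (ℤ.- (+ k)) (ℤ.- (+ 1)) e) (≡.cong (_/ e)
      (≡.trans (≡.sym (ℤ.neg-distrib-+ (+ k) (+ 1))) (≡.cong (λ n → ℤ.- (+ n)) (ℕ.+-comm k 1))))
    rearranged : ϖ k * rest ≈ x - sum (λ i → toℕ (a i) · (ϖ k * u i))
    rearranged = begin
      ϖ k * (x * ϖ#0 ⁻¹ - D)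
        ≈⟨ solve 4 (λ b x i d → b :* (x :* i :- d) := x :* (b :* i) :- b :* d)
             refl (ϖ k) x (ϖ#0 ⁻¹) D ⟩
      x * (ϖ k * ϖ#0 ⁻¹) - ϖ k * D
        ≈⟨ +-cong (trans (*-congˡ (⁻¹-inverseʳ ϖ#0)) (*-identityʳ x))
             (-‿cong (trans (*-distribˡ-sum (ϖ k) (λ i → toℕ (a i) · u i))
                            (sum-cong-≋ λ i → ×-comm-* (toℕ (a i)) (ϖ k) (u i)))) ⟩
      x - sum (λ i → toℕ (a i) · (ϖ k * u i)) ∎
      where D = sum λ i → toℕ (a i) · u i

  -- Each of the r steps contributes the f elements ϖ k · uᵢ and improves the error by p^(-1/e). The
  -- family `w` is fixed before x is given, so one family serves every x.
  expansion : ∀ r k → ∃[ n ] Σ[ w ∈ (Fin n → Carrier) ] (∀ i → ∣ w i ∣≤p^ 0ℚ) ×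
    (∀ x → ∣ x ∣≤p^ (ℤ.- (+ k) / e) →
      Σ[ d ∈ (Fin n → ℕ) ] ∣ x - sum (λ i → d i · w i) ∣≤p^ (ℤ.- (+ (r ℕ.+ k)) / e))
  expansion zero k = 0 , (λ ()) , (λ ()) , λ x ∣x∣≤ → (λ ()) , ≤p^-cong (sym (x-0≈x x)) ∣x∣≤
  expansion (suc r) k =
    let n , w , ∣w∣≤1 , approximate = expansion r (suc k)
        w₀ = λ i → ϖ k * u i
    in f ℕ.+ n , w₀ ++ w , ∣++∣≤1 w₀ w ∣w₀∣≤1 ∣w∣≤1 , λ x ∣x∣≤ →
      let a , ∣x-a∣≤ = leading-digits k x ∣x∣≤
          x₁ = x - sum (λ i → toℕ (a i) · w₀ i)
          d , ∣x-d∣≤ = approximate x₁ ∣x-a∣≤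
      in (toℕ ∘ a) ++ d ,
         ≤p^-respʳ (≡.cong (λ n → ℤ.- (+ n) / e) (ℕ.+-suc r k))
           (≤p^-cong (trans
             (solve 3 (λ x a b → (x :- a) :- b := x :- (a :+ b)) refl x _ _)
             (+-congˡ (-‿cong (sym (sum-++-· (toℕ ∘ a) w₀ d w)))))
             ∣x-d∣≤)
    where
    ∣w₀∣≤1 : ∀ i → ∣ ϖ k * u i ∣≤p^ 0ℚ
    ∣w₀∣≤1 i = ≤p^-respʳ (ℚ.+-identityˡ 0ℚ) (≤p^-*
      (≤p^-weaken (ℚ.≤-trans (/-mono-≤ e (ℤ.neg-mono-≤ (ℤ.+≤+ (ℕ.z≤n {k}))))
                              (ℚ.≤-reflexive (ℚ.0/n≡0 e)))
        (≡p^⇒≤p^ (∣ϖ∣ k)))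
      (proj₁ (proj₂ residue) i))
    ∣++∣≤1 : ∀ {m n} (v : Fin m → Carrier) (w : Fin n → Carrier) →
             (∀ i → ∣ v i ∣≤p^ 0ℚ) → (∀ i → ∣ w i ∣≤p^ 0ℚ) → ∀ i → ∣ (v ++ w) i ∣≤p^ 0ℚ
    ∣++∣≤1 {m} v w ∣v∣ ∣w∣ i with splitAt m i
    ... | inj₁ j = ∣v∣ j
    ... | inj₂ j = ∣w∣ j
    sum-++-· : ∀ {m n} (a : Fin m → ℕ) v (d : Fin n → ℕ) w →
      sum (λ i → (a ++ d) i · (v ++ w) i) ≈ sum (λ i → a i · v i) + sum (λ i → d i · w i)
    sum-++-· {m} a v d w = trans (reflexive (sum-cong-≗ pointwise))
      (sum-++ (CommutativeRing.+-monoid commutativeRing) (λ i → a i · v i) (λ i → d i · w i))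
      where
      pointwise : ∀ i → (a ++ d) i · (v ++ w) i ≡ ((λ i → a i · v i) ++ (λ i → d i · w i)) i
      pointwise i with splitAt m i
      ... | inj₁ _ = ≡.refl
      ... | inj₂ _ = ≡.refl

  integral-approximation : ∃[ n ] Σ[ w ∈ (Fin n → Carrier) ] (∀ i → ∣ w i ∣≤p^ 0ℚ) ×
    (∀ x → ∣ x ∣≤p^ 0ℚ → Σ[ d ∈ (Fin n → ℕ) ] ∣ x - sum (λ i → d i · w i) ∣≤p^- 1)
  integral-approximation =
    -- The e steps of size 1/e lead from exponent 0 to -1, that is, to precision p^-1.
    let n , w , ∣w∣≤1 , approximate = expansion e 0 in
    n , w , ∣w∣≤1 , λ x ∣x∣≤1 →
      let d , ∣x-d∣≤ = approximate x (≤p^-respʳ (≡.sym (ℚ.0/n≡0 e)) ∣x∣≤1) in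
      d , ≤p^-respʳ e/e≡1 ∣x-d∣≤
    where
    e/e≡1 : ℤ.- (+ (e ℕ.+ 0)) / e ≡ -ℚ (+ 1 / 1)
    e/e≡1 = ≡.trans (≡.cong (_/ e) (≡.trans
      (≡.cong (λ n → ℤ.- (+ n)) (ℕ.+-identityʳ e)) (≡.sym (ℤ.-1*i≡-i (+ e)))))
      (*-cancel-/ (ℤ.- (+ 1)) e)

-- Convergence for partial quotients in Z

lemma8 : ∀ {c ℓ₁ ℓ₂ c′ ℓ₁′ ℓ₂′ : Level}
    (p : ℕ) .{{_ : NonZero p}} → Prime p →
    (Qp : ValuedField c ℓ₁ ℓ₂) (isQp : IsPadicNumbers p Qp)
    (K : ValuedField c′ ℓ₁′ ℓ₂′) (E : Extension Qp K) →
    let open ValuedField K in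
    let open Extension E in
    (m e f : ℕ) .{{_ : NonZero e}} →
    HasDegree U m → HasRamificationIndex U e → HasResidueDegree p f →
    (γ β : Carrier) →
    let L = Adjoin Base γ in
    IsPrimitiveRoot (p ^ℕ f ∸ 1) γ →
    HasDegree L f → HasRamificationIndex L 1 →
    (∀ x → x ∈ Adjoin L β) → ∣ β ∣≡p^ (+ 1 / e) →
    (D : DigitSet p) (a : ℕ → Carrier) →
    (∀ j → a j ∈ Z isQp E e f γ β D) →
    (∀ j → a (suc j) ∈ Z* isQp E e f γ β D) →
    let s = numerator a in
    let t = denominator a in
    Σ[ t#0 ∈ (∀ n → t n # 0#) ]
    (∀ n → ContinuedFraction a n (s n ÷ t#0 n)) ×
    (∃[ α ] ((λ n → s n ÷ t#0 n) ⟶ α) ×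
    (∀ n → ∣ α - s n ÷ t#0 n ∣≡p^ (-ℚ (log (t#0 n) +ℚ log (t#0 (suc n))))))
lemma8 p p-prime Qp isQp K E m e f _ ramification residue γ β _ _ _ _ _ D a _ a∈Z* =
  t#0 , (λ n → continuedFraction a ∣a∣>1 n (t#0 n)) , convergence e 1/e≤log-a K-complete
  where
  open ValuedField K using (∣_∣>1; IsComplete)
  ∣a∣>1 : ∀ n → ∣ a (suc n) ∣>1
  ∣a∣>1 n = proj₂ (a∈Z* n)
  open ContinuedFractions K using (continuedFraction)
  open ContinuedFractions.Convergents K a ∣a∣>1 using (t#0; log-a; convergence)
  1/e≤log-a : ∀ n → + 1 / e ℚ.≤ log-a n
  -- The exponent is positive and lies in (1/e)ℤ, hence is at least 1/e.
  1/e≤log-a n = let a#0 , 0<log = ∣a∣>1 n ; k , log≡k/e = proj₁ ramification _ a#0 in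
    ≡.subst (+ 1 / e ℚ.≤_) (≡.sym log≡k/e) (/-positive⇒1/≤ e k (≡.subst (0ℚ ℚ.<_) log≡k/e 0<log))
  K-complete : IsComplete
  K-complete =
    let n , w , ∣w∣≤1 , approximate = DigitExpansion.integral-approximation K e ramification residue
        1<p = ℕ.nonTrivial⇒n>1 p {{prime⇒nonTrivial p-prime}}
    in ExtensionProperties.extension-complete E (IsPadicNumbers.complete isQp)
         (proj₂ (∃uniformizer isQp 1<p)) w ∣w∣≤1 approximate
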